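{- For any finite, connected, undirected graph $G=(V,E)$ with $|V|\ge 2$, there exists a parallel chip-firing game on $G$ with period $T=2$.
   Context: A parallel chip-firing game on an undirected graph $G$ starts with a finite nonnegative integer number of chips on each vertex. In each round, simultaneously, every vertex having at least as many chips as neighbors fires, sending one chip to each of its neighbors; all other vertices wait. The game has period $T$ if $T$ is the smallest positive integer for which there is a round $t_0$ such that every vertex has the same number of chips in round $t$ as in round $t+T$ for all $t\ge t_0$. -}

module Defs where

open import Data.Bool.Base using (if_then_else_)
open import Data.Fin.Base using (Fin)
open import Data.List.Base using (List; allFin; filter; length)
open import Data.Nat.Base using (ℕ; zero; suc; _+_; _∸_; _≤_; _<_)
open import Data.Nat.Properties using (_≤?_)
open import Data.Product.Base using (∃; _×_)
open import Level using (0ℓ)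
open import Relation.Binary.Construct.Closure.ReflexiveTransitive using (Star)
open import Relation.Binary.Core using (Rel)
open import Relation.Binary.Definitions using (Decidable; Irreflexive; Symmetric)
open import Relation.Binary.PropositionalEquality.Core using (_≡_)
open import Relation.Nullary.Decidable.Core using (does)
open import Relation.Unary using () renaming (Decidable to Decidable₁)

-- Finite simple graphs on the vertex set Fin n.
record Graph (n : ℕ) : Set₁ where
  field
    Adj    : Rel (Fin n) 0ℓ
    adj?   : Decidable Adj
    sym    : Symmetric Adj
    irrefl : Irreflexive _≡_ Adj

Connected : ∀ {n} → Graph n → Set
Connected G = ∀ u v → Star (Graph.Adj G) u v

Chips : ℕ → Set
Chips n = Fin n → ℕ

module _ {n : ℕ} (G : Graph n) where

  open Graph G

  neighbours : Fin n → List (Fin n)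
  neighbours v = filter (adj? v) (allFin n)

  degree : Fin n → ℕ
  degree v = length (neighbours v)

  Fires : Chips n → Fin n → Set
  Fires c v = degree v ≤ c v

  fires? : (c : Chips n) → Decidable₁ (Fires c)
  fires? c v = degree v ≤? c v

  -- The subtraction never truncates: it is only used when degree v ≤ c v.
  afterSending : Chips n → Chips n
  afterSending c v = if does (fires? c v) then c v ∸ degree v else c v

  received : Chips n → Chips n
  received c v = length (filter (fires? c) (neighbours v))

  step : Chips n → Chips n
  step c v = afterSending c v + received c v

  -- The game is deterministic, so an initial position c determines it;
  -- chipsAt c t is the position in round t.
  chipsAt : Chips n → ℕ → Chips n
  chipsAt c zero    = c
  chipsAt c (suc t) = step (chipsAt c t)

  EventuallyRepeats : Chips n → ℕ → Set
  EventuallyRepeats c T =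
    ∃ λ t₀ → ∀ t → t₀ ≤ t → ∀ v → chipsAt c t v ≡ chipsAt c (t + T) v

  HasPeriod : Chips n → ℕ → Set
  HasPeriod c T =
    0 < T × EventuallyRepeats c T ×
    (∀ T′ → 0 < T′ → EventuallyRepeats c T′ → T ≤ T′)

{-# OPTIONS --safe #-}
-- Take a maximal independent set I. As no vertex is isolated, every vertex has
-- a neighbour on the other side of the partition {I , V ∖ I}. Give each
-- vertex of one side as many chips as its degree, and each vertex of the other
-- side as many chips as it has neighbours on its own side, which is fewer than
-- its degree. Then exactly the first side fires, after which the two sides
-- have swapped roles.
module Submission where

open import Defs
open import Data.Bool.Base using (Bool; true; not; if_then_else_)
open import Data.Bool.Properties using (_≟_; not-involutive; not-¬; ¬-not)
open import Data.Fin.Base using (Fin; zero; suc)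
open import Data.Fin.Properties using () renaming (_≟_ to _≟ᶠ_)
open import Data.List.Base using (List; []; _∷_; allFin; filter; length)
open import Data.List.Membership.Propositional using (_∈_; lose; find)
open import Data.List.Membership.Propositional.Properties using (∈-filter⁺; ∈-allFin)
open import Data.List.Properties using (filter-≐; filter-notAll)
open import Data.List.Relation.Unary.Any using (Any; here; there; any?)
open import Data.Nat.Base using (ℕ; zero; suc; _+_; _≤_; _<_; z≤n; s≤s)
open import Data.Nat.Properties
  using (+-comm; +-suc; ≤-refl; ≤-reflexive; <⇒≱; <⇒≢; n∸n≡0)
open import Data.Product.Base using (∃; _×_; _,_)
open import Data.Sum.Base as Sum using (_⊎_; inj₁; inj₂)
open import Function.Base using (_∘_)
open import Level using (Level)
open import Relation.Binary.Construct.Closure.ReflexiveTransitive using (ε; _◅_)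
open import Relation.Binary.PropositionalEquality
open import Relation.Nullary using (¬_; does; yes; no; contradiction)
open import Relation.Nullary.Decidable using (dec-true; dec-false)
open import Relation.Unary using (Pred; Decidable)
open import Relation.Unary.Properties using (∁?)

private
  variable
    a p : Level
    A : Set a
    n : ℕ

length-filter-∁ : {P : Pred A p} (P? : Decidable P) (xs : List A) →
  length (filter P? xs) + length (filter (∁? P?) xs) ≡ length xs
length-filter-∁ P? [] = refl
length-filter-∁ P? (x ∷ xs) with P? x
... | yes _ = cong suc (length-filter-∁ P? xs)
... | no  _ = trans (+-suc _ _) (cong suc (length-filter-∁ P? xs))

∃-distinct : 2 ≤ n → (v : Fin n) → ∃ λ u → v ≢ u
∃-distinct (s≤s (s≤s _)) zero    = suc zero , λ ()
∃-distinct (s≤s (s≤s _)) (suc v) = zero , λ ()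

module _ (G : Graph n) where

  open Graph G renaming (sym to Adj-sym)
  open import Data.List.Membership.DecPropositional (_≟ᶠ_ {n}) using (_∈?_)

  -- A walk from `v` to some other vertex is nonempty, and its first edge leads to a neighbour.
  connected⇒neighbour : 2 ≤ n → Connected G → ∀ v → ∃ (Adj v)
  connected⇒neighbour 2≤n conn v with ∃-distinct 2≤n v
  ... | u , v≢u with conn v u
  ...   | ε               = contradiction refl v≢u
  ...   | _◅_ {j = w} e _ = w , e

  Independent : List (Fin n) → Set
  Independent I = ∀ {u w} → u ∈ I → w ∈ I → ¬ Adj u w

  -- Greedy choice: `x` joins `I` exactly when it has no neighbour there yet. Domination is
  -- restricted to `xs` for the induction; for `allFin n` it says that `I` is maximal.
  maximalIndependent : (xs : List (Fin n)) →
    ∃ λ I → Independent I × (∀ {v} → v ∈ xs → v ∈ I ⊎ Any (Adj v) I)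
  maximalIndependent [] = [] , (λ ()) , λ ()
  maximalIndependent (x ∷ xs) with maximalIndependent xs
  ... | I , ind , dom with any? (adj? x) I
  ...   | yes x~I = I , ind , λ { (here refl) → inj₂ x~I ; (there v∈) → dom v∈ }
  ...   | no x≁I = x ∷ I , ind′ , dom′
    where
    ind′ : Independent (x ∷ I)
    ind′ (here refl) (here refl) e = irrefl refl e
    ind′ (here refl) (there w∈)  e = x≁I (lose w∈ e)
    ind′ (there u∈)  (here refl) e = x≁I (lose u∈ (Adj-sym e))
    ind′ (there u∈)  (there w∈)  e = ind u∈ w∈ e

    dom′ : ∀ {v} → v ∈ x ∷ xs → v ∈ x ∷ I ⊎ Any (Adj v) (x ∷ I)
    dom′ (here refl) = inj₁ (here refl)
    dom′ (there v∈)  = Sum.map there there (dom v∈)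

  NowhereMonochromatic : (Fin n → Bool) → Set
  NowhereMonochromatic s = ∀ v → ∃ λ w → Adj v w × s w ≢ s v

  -- For `v` in `I`, independence puts any neighbour outside `I`. For `v` outside, domination
  -- supplies a neighbour inside.
  ∃-nowhereMonochromatic : (∀ v → ∃ (Adj v)) → ∃ NowhereMonochromatic
  ∃-nowhereMonochromatic neighbour with maximalIndependent (allFin n)
  ... | I , ind , dom = s , other
    where
    s : Fin n → Bool
    s v = does (v ∈? I)

    differ : ∀ {u w} → u ∈ I → ¬ w ∈ I → s u ≢ s w
    differ {u} {w} u∈ w∉ eq
      with () ← trans (sym (dec-true (u ∈? I) u∈)) (trans eq (dec-false (w ∈? I) w∉))

    other : NowhereMonochromatic s
    other v with v ∈? I in eq | dom (∈-allFin v)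
    ... | yes v∈ | _ = let w , e = neighbour v in
      w , e , λ sw≡ → differ v∈ (λ w∈ → ind v∈ w∈ e) (trans (cong does eq) (sym sw≡))
    ... | no v∉ | inj₁ v∈ = contradiction v∈ v∉
    ... | no v∉ | inj₂ v~ = let w , w∈ , e = find v~ in
      w , e , λ sw≡ → differ w∈ v∉ (trans sw≡ (sym (cong does eq)))

  module Alternating (s : Fin n → Bool) (other : NowhereMonochromatic s) where

    ownColour : Fin n → ℕ
    ownColour v = length (filter (λ w → s w ≟ s v) (neighbours G v))

    -- The filter drops the neighbour of the other colour. Strictness both keeps the waiting side
    -- from firing and separates the two alternating positions.
    ownColour<degree : ∀ v → ownColour v < degree G v
    ownColour<degree v = let w , e , sw≢sv = other v in
      filter-notAll (λ w → s w ≟ s v) (neighbours G v)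
        (lose (∈-filter⁺ (adj? v) (∈-allFin w) e) sw≢sv)

    -- `b` is the colour about to fire.
    ready : Bool → Chips n
    ready b v = if does (s v ≟ b) then degree G v else ownColour v

    ready-≡ : ∀ {b v} → s v ≡ b → ready b v ≡ degree G v
    ready-≡ {b} {v} eq rewrite dec-true (s v ≟ b) eq = refl

    ready-≢ : ∀ {b v} → s v ≢ b → ready b v ≡ ownColour v
    ready-≢ {b} {v} neq rewrite dec-false (s v ≟ b) neq = refl

    -- Of the two values at `v`, one is its degree and the other is `ownColour v`. This excludes
    -- period 1.
    ready-not : ∀ b v → ready b v ≢ ready (not b) v
    ready-not b v eq with s v ≟ b
    ... | yes sv≡b = <⇒≢ (ownColour<degree v)
      (trans (sym (ready-≢ (not-¬ sv≡b))) (sym eq))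
    ... | no sv≢b = <⇒≢ (ownColour<degree v)
      (trans eq (ready-≡ (¬-not sv≢b)))

    module _ {c : Chips n} {b : Bool} (c≗ : c ≗ ready b) where

      ≡⇒fires : ∀ {v} → s v ≡ b → Fires G c v
      ≡⇒fires {v} eq = ≤-reflexive (sym (trans (c≗ v) (ready-≡ eq)))

      ≢⇒¬fires : ∀ {v} → s v ≢ b → ¬ Fires G c v
      ≢⇒¬fires {v} neq = <⇒≱
        (subst (_< degree G v) (sym (trans (c≗ v) (ready-≢ neq))) (ownColour<degree v))

      fires⇒≡ : ∀ {v} → Fires G c v → s v ≡ b
      fires⇒≡ {v} f with s v ≟ b
      ... | yes eq = eq
      ... | no neq = contradiction f (≢⇒¬fires neq)

      -- A firing vertex spends all its chips and gets one back from each neighbour of its own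
      -- colour. A waiting vertex adds one chip per neighbour of the other colour to its
      -- `ownColour v`, reaching its degree. Assuming only pointwise equality of `c` with `ready b`
      -- allows iteration without function extensionality.
      step-ready : step G c ≗ ready (not b)
      step-ready v with s v ≟ b
      ... | yes refl
        rewrite dec-true (fires? G c v) (≡⇒fires refl)
              | c≗ v | ready-≡ {v = v} refl | n∸n≡0 (degree G v)
              | ready-≢ {v = v} (not-¬ refl)
        = cong length (filter-≐ (fires? G c) (λ w → s w ≟ s v)
            (fires⇒≡ , ≡⇒fires) (neighbours G v))
      ... | no neq
        rewrite dec-false (fires? G c v) (≢⇒¬fires neq)
              | c≗ v | ready-≢ {v = v} neq | ready-≡ {v = v} (¬-not neq)
        = trans
            (cong (λ ws → ownColour v + length ws)
              (filter-≐ (fires? G c) (∁? (λ w → s w ≟ s v))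
                -- The neighbours that fire are those coloured unlike `v`: with two colours, `s w`
                -- and `b` agree once both differ from `s v`.
                ( (λ f sw≡sv → neq (trans (sym sw≡sv) (fires⇒≡ f)))
                , (λ sw≢sv → ≡⇒fires (trans (¬-not sw≢sv) (sym (¬-not (neq ∘ sym))))))
                (neighbours G v)))
            (length-filter-∁ (λ w → s w ≟ s v) (neighbours G v))

    turn : ℕ → Bool
    turn zero    = true
    turn (suc t) = not (turn t)

    chipsAt-ready : ∀ t → chipsAt G (ready true) t ≗ ready (turn t)
    chipsAt-ready zero    v = refl
    chipsAt-ready (suc t) v = step-ready (chipsAt-ready t) v

    repeats₂ : EventuallyRepeats G (ready true) 2
    repeats₂ = 0 , λ t _ v → begin
      chipsAt G (ready true) t v        ≡⟨ chipsAt-ready t v ⟩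
      ready (turn t) v                  ≡⟨ cong (λ b → ready b v) (not-involutive (turn t)) ⟨
      ready (turn (2 + t)) v            ≡⟨ chipsAt-ready (2 + t) v ⟨
      chipsAt G (ready true) (2 + t) v  ≡⟨ cong (λ k → chipsAt G (ready true) k v) (+-comm 2 t) ⟩
      chipsAt G (ready true) (t + 2) v  ∎
      where open ≡-Reasoning

    -- The vertex argument is the place where consecutive positions differ; on an empty vertex set
    -- all positions would agree.
    ¬repeats₁ : Fin n → ¬ EventuallyRepeats G (ready true) 1
    ¬repeats₁ v (t , rep) = ready-not (turn t) v (begin
      ready (turn t) v                  ≡⟨ chipsAt-ready t v ⟨
      chipsAt G (ready true) t v        ≡⟨ rep t ≤-refl v ⟩
      chipsAt G (ready true) (t + 1) v  ≡⟨ cong (λ k → chipsAt G (ready true) k v) (+-comm t 1) ⟩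
      chipsAt G (ready true) (1 + t) v  ≡⟨ chipsAt-ready (1 + t) v ⟩
      ready (not (turn t)) v            ∎)
      where open ≡-Reasoning

    hasPeriod₂ : Fin n → HasPeriod G (ready true) 2
    hasPeriod₂ v = s≤s z≤n , repeats₂ , λ where
      1             _ rep → contradiction rep (¬repeats₁ v)
      (suc (suc _)) _ _   → s≤s (s≤s z≤n)

lemmaA1 : ∀ (n : ℕ) (G : Graph n) → 2 ≤ n → Connected G → ∃ λ (c : Chips n) → HasPeriod G c 2
lemmaA1 (suc n) G 2≤n conn
  with s , other ← ∃-nowhereMonochromatic G (connected⇒neighbour G 2≤n conn)
  = ready true , hasPeriod₂ zero
  where open Alternating G s other
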